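{- Let $n\ge 1$ and let $a_i=F_{i+2}-i-2$ for $i\ge 1$. Every game path of the Zeckendorf game on $n$ (starting from $\{F_1^n\}$) has length at most $\sum_{i=1}^{i_{\max}(n)} a_i\,\delta_i$, and $$\sum_{i=1}^{i_{\max}(n)} a_i\,\delta_i\ \le\ \frac{3+\sqrt5}{2}\,n-IZ(n)-\frac{1+\sqrt5}{2}\,Z(n).$$
   Context: Fibonacci numbers are indexed by $F_1=1$, $F_2=2$, $F_{i+1}=F_i+F_{i-1}$. A game state is a finite multiset of Fibonacci numbers (tracked by index); $\{F_1^n\}$ denotes $n$ copies of $F_1$. The legal moves are: $C_1$: replace $F_1,F_1$ by $F_2$; for $i\ge 2$, $C_i$: replace $F_{i-1},F_i$ by $F_{i+1}$; $S_2$: replace $F_2,F_2$ by $F_1,F_3$; for $i\ge 3$, $S_i$: replace $F_i,F_i$ by $F_{i-2},F_{i+1}$. The game on $n$ starts at $\{F_1^n\}$ and a game path is a sequence of legal moves continued until no legal move is available, which happens exactly at the Zeckendorf decomposition of $n$ (the unique representation of $n$ as a sum of $F_i$'s with distinct, pairwise non-consecutive indices); the length of a path is its number of moves. Write the Zeckendorf decomposition as $n=\sum_{i=1}^{i_{\max}(n)}\delta_i F_i$ with $\delta_i\in\{0,1\}$ and $i_{\max}(n)$ the largest index occurring; $Z(n)=\sum_i\delta_i$ and $IZ(n)=\sum_i i\,\delta_i$. -}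

module Defs where

open import Data.Nat.Base as ℕ using (ℕ; zero; suc; z≤n; s≤s)
import Data.Nat.Properties as ℕₚ
open import Data.Integer.Base as ℤ using (ℤ; +_)
open import Data.Rational.Base as ℚ using (ℚ; 0ℚ; 1ℚ; ½)
open import Data.List.Base using (List; []; _∷_; _++_; replicate)
open import Data.List.Relation.Binary.Permutation.Propositional using (_↭_)
open import Data.Product.Base using (_×_; _,_)
open import Data.Sum.Base using (_⊎_; inj₁; inj₂)
open import Data.Empty using (⊥-elim)
open import Relation.Nullary using (¬_; yes; no)
open import Relation.Binary.Construct.Closure.ReflexiveTransitive using (Star; ε; _◅_)
open import Relation.Binary.PropositionalEquality

-- F 1 = 1, F 2 = 2; the value F 0 = 1 extends the recurrence downwards and is
-- never used as a summand.
F : ℕ → ℕ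
F 0             = 1
F 1             = 1
F (suc (suc i)) = F (suc i) ℕ.+ F i

-- ∑₁ m f = f 1 + ⋯ + f m
∑₁ : ℕ → (ℕ → ℕ) → ℕ
∑₁ zero    f = 0
∑₁ (suc m) f = ∑₁ m f ℕ.+ f (suc m)

∑₁ℤ : ℕ → (ℕ → ℤ) → ℤ
∑₁ℤ zero    f = + 0
∑₁ℤ (suc m) f = ∑₁ℤ m f ℤ.+ f (suc m)

-- A multiset of Fibonacci numbers is the list of their indices, taken up to
-- permutation (see _⟶_).
State : Set
State = List ℕ

-- C k is the move C_{k+2} and S k is the move S_{k+3}, for k ≥ 0.
data Rule : State → State → Set where
  C₁ :         Rule (1 ∷ 1 ∷ [])                 (2 ∷ [])
  C  : ∀ k →   Rule (1 ℕ.+ k ∷ 2 ℕ.+ k ∷ [])     (3 ℕ.+ k ∷ [])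
  S₂ :         Rule (2 ∷ 2 ∷ [])                 (1 ∷ 3 ∷ [])
  S  : ∀ k →   Rule (3 ℕ.+ k ∷ 3 ℕ.+ k ∷ [])     (1 ℕ.+ k ∷ 4 ℕ.+ k ∷ [])

infix 4 _⟶_

data _⟶_ (s t : State) : Set where
  move : ∀ {old new} rest → Rule old new →
         s ↭ old ++ rest → t ↭ new ++ rest → s ⟶ t

Terminal : State → Set
Terminal s = ∀ t → ¬ (s ⟶ t)

start : ℕ → State
start n = replicate n 1

record GamePath (n : ℕ) : Set where
  field
    end      : State
    moves    : Star _⟶_ (start n) end
    terminal : Terminal end

#moves : ∀ {s t} → Star _⟶_ s t → ℕ
#moves ε        = 0
#moves (_ ◅ ms) = suc (#moves ms)

pathLength : ∀ {n} → GamePath n → ℕ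
pathLength p = #moves (GamePath.moves p)

record Zeckendorf (n : ℕ) : Set where
  field
    iₘₐₓ           : ℕ
    δ              : ℕ → ℕ
    δ-binary       : ∀ i → δ i ≡ 0 ⊎ δ i ≡ 1
    iₘₐₓ-positive  : 1 ℕ.≤ iₘₐₓ
    iₘₐₓ-occurs    : δ iₘₐₓ ≡ 1
    iₘₐₓ-largest   : ∀ i → iₘₐₓ ℕ.< i → δ i ≡ 0
    nonconsecutive : ∀ i → 1 ℕ.≤ i → ¬ (δ i ≡ 1 × δ (suc i) ≡ 1)
    represents     : n ≡ ∑₁ iₘₐₓ (λ i → δ i ℕ.* F i)

  Z : ℕ
  Z = ∑₁ iₘₐₓ δ

  IZ : ℕ
  IZ = ∑₁ iₘₐₓ (λ i → i ℕ.* δ i)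

a : ℕ → ℤ
a i = + F (i ℕ.+ 2) ℤ.- + i ℤ.- + 2

∑aδ : ∀ {n} → Zeckendorf n → ℤ
∑aδ z = ∑₁ℤ iₘₐₓ (λ i → a i ℤ.* + δ i)
  where open Zeckendorf z

infix 5 _+_√5

-- The subfield ℚ(√5) of ℝ: p + q √5 stands for the real number p + q√5.
record ℚ√5 : Set where
  constructor _+_√5
  field
    rat irr : ℚ

open ℚ√5

√5 : ℚ√5
√5 = 0ℚ + 1ℚ √5

fromℤ : ℤ → ℚ√5
fromℤ i = (i ℚ./ 1) + 0ℚ √5

fromℕ : ℕ → ℚ√5
fromℕ n = fromℤ (+ n)

infixl 6 _⊕_ _⊖_
infixl 7 _⊗_
infixl 8 _/2

_⊕_ _⊖_ _⊗_ : ℚ√5 → ℚ√5 → ℚ√5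
x ⊕ y = (rat x ℚ.+ rat y) + (irr x ℚ.+ irr y) √5
x ⊖ y = (rat x ℚ.- rat y) + (irr x ℚ.- irr y) √5
x ⊗ y = (rat x ℚ.* rat y ℚ.+ (+ 5 ℚ./ 1) ℚ.* (irr x ℚ.* irr y))
      + (rat x ℚ.* irr y ℚ.+ irr x ℚ.* rat y) √5

_/2 : ℚ√5 → ℚ√5
x /2 = (½ ℚ.* rat x) + (½ ℚ.* irr x) √5

-- The sign of the real number p + q√5 (√5 the positive root): if p and q have
-- opposite signs, compare p² with (q√5)² = 5q².
data NonNeg : ℚ√5 → Set where
  p≥0,q≥0 : ∀ {p q} → 0ℚ ℚ.≤ p → 0ℚ ℚ.≤ q → NonNeg (p + q √5)
  p≥0,q≤0 : ∀ {p q} → 0ℚ ℚ.≤ p → q ℚ.≤ 0ℚ →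
            (+ 5 ℚ./ 1) ℚ.* (q ℚ.* q) ℚ.≤ p ℚ.* p → NonNeg (p + q √5)
  p≤0,q≥0 : ∀ {p q} → p ℚ.≤ 0ℚ → 0ℚ ℚ.≤ q →
            p ℚ.* p ℚ.≤ (+ 5 ℚ./ 1) ℚ.* (q ℚ.* q) → NonNeg (p + q √5)

infix 4 _≼_

_≼_ : ℚ√5 → ℚ√5 → Set
x ≼ y = NonNeg (y ⊖ x)

√5-squared : √5 ⊗ √5 ≡ fromℕ 5
√5-squared = refl

private
  ∑₁-cong : ∀ m {f g : ℕ → ℕ} → (∀ i → i ℕ.≤ m → f i ≡ g i) → ∑₁ m f ≡ ∑₁ m g
  ∑₁-cong zero    e = refl
  ∑₁-cong (suc m) e =
    cong₂ ℕ._+_ (∑₁-cong m (λ i i≤m → e i (ℕₚ.m≤n⇒m≤1+n i≤m))) (e (suc m) ℕₚ.≤-refl)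

  ∑₁-extend : ∀ k m {f : ℕ → ℕ} → k ℕ.≤′ m → (∀ i → k ℕ.< i → f i ≡ 0) → ∑₁ m f ≡ ∑₁ k f
  ∑₁-extend k .k ℕ.≤′-refl _ = refl
  ∑₁-extend k (suc m) (ℕ.≤′-step k≤m) z =
    trans (cong₂ ℕ._+_ (∑₁-extend k m k≤m z) (z (suc m) (s≤s (ℕₚ.≤′⇒≤ k≤m))))
          (ℕₚ.+-identityʳ _)

  set : ℕ → (ℕ → ℕ) → ℕ → ℕ
  set j f i with i ℕₚ.≟ j
  ... | yes _ = 1
  ... | no  _ = f i

  set-same : ∀ j f → set j f j ≡ 1
  set-same j f with j ℕₚ.≟ j
  ... | yes _ = refl
  ... | no ¬e = ⊥-elim (¬e refl)

  set-other : ∀ j f i → i ≢ j → set j f i ≡ f i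
  set-other j f i ne with i ℕₚ.≟ j
  ... | yes e = ⊥-elim (ne e)
  ... | no _  = refl

  -- A possibly empty decomposition with all indices at most m.
  record Below (m n : ℕ) : Set where
    field
      δ      : ℕ → ℕ
      binary : ∀ i → δ i ≡ 0 ⊎ δ i ≡ 1
      above  : ∀ i → m ℕ.< i → δ i ≡ 0
      noncon : ∀ i → 1 ℕ.≤ i → ¬ (δ i ≡ 1 × δ (suc i) ≡ 1)
      sums   : n ≡ ∑₁ m (λ i → δ i ℕ.* F i)

  empty : ∀ {n} → n ℕ.< 1 → Below 0 n
  empty n<1 = record
    { δ = λ _ → 0 ; binary = λ _ → inj₁ refl ; above = λ _ _ → refl
    ; noncon = λ { _ _ (() , _) } ; sums = ℕₚ.n<1⇒n≡0 n<1 }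

  weaken : ∀ {m n} → Below m n → Below (suc m) n
  weaken {m} b = record
    { δ = δ ; binary = binary ; noncon = noncon
    ; above = λ i lt → above i (ℕₚ.<-trans (ℕₚ.n<1+n m) lt)
    ; sums = trans sums (sym (∑₁-extend m (suc m) (ℕ.≤′-step ℕ.≤′-refl)
                                (λ i lt → cong (ℕ._* F i) (above i lt)))) }
    where open Below b

  add : ∀ {r} j → Below (ℕ.pred j) r → Below (suc j) (r ℕ.+ F (suc j))
  add {r} j b = record
    { δ = δ′ ; binary = bin ; above = ab ; noncon = nc ; sums = sm }
    where
    m = ℕ.pred j
    m≤j = ℕₚ.pred[n]≤n {j}
    open Below b
    δ′ = set (suc j) δ
    bin : ∀ i → δ′ i ≡ 0 ⊎ δ′ i ≡ 1
    bin i with i ℕₚ.≟ suc j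
    ... | yes _ = inj₂ refl
    ... | no _  = binary i
    ab : ∀ i → suc j ℕ.< i → δ′ i ≡ 0
    ab i lt = trans (set-other (suc j) δ i (λ e → ℕₚ.<⇒≢ lt (sym e)))
                    (above i (ℕₚ.≤-trans (s≤s m≤j) (ℕₚ.<⇒≤ lt)))
    0≢1 : ∀ {x} → x ≡ 0 → ¬ (x ≡ 1)
    0≢1 refl ()
    δj : 1 ℕ.≤ j → δ j ≡ 0
    δj 1≤j = above j (ℕₚ.≤-reflexive (ℕₚ.suc-pred j {{ℕ.>-nonZero 1≤j}}))
    nc : ∀ i → 1 ℕ.≤ i → ¬ (δ′ i ≡ 1 × δ′ (suc i) ≡ 1)
    nc i 1≤i (p , q) with i ℕₚ.≟ suc j | suc i ℕₚ.≟ suc j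
    ... | yes refl | yes e    = ⊥-elim (ℕₚ.1+n≢n e)
    ... | yes refl | no _     = 0≢1 (above (suc (suc j)) (s≤s (ℕₚ.m≤n⇒m≤1+n m≤j))) q
    ... | no _     | yes refl = 0≢1 (δj 1≤i) p
    ... | no _     | no _     = noncon i 1≤i (p , q)
    sm : r ℕ.+ F (suc j) ≡ ∑₁ (suc j) (λ i → δ′ i ℕ.* F i)
    sm = cong₂ ℕ._+_
      (trans sums (trans
        (sym (∑₁-extend m j (ℕₚ.≤⇒≤′ m≤j) (λ i lt → cong (ℕ._* F i) (above i lt))))
        (∑₁-cong j (λ i i≤j → cong (ℕ._* F i)
          (sym (set-other (suc j) δ i (λ e → ℕₚ.<⇒≢ (s≤s i≤j) e)))))))
      (sym (trans (cong (ℕ._* F (suc j)) (set-same (suc j) δ)) (ℕₚ.*-identityˡ _)))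

  greedy : ∀ m n → n ℕ.< F (suc m) → Below m n
  top : ∀ m r → r ℕ.< F m → Below (ℕ.pred m) r

  greedy zero    n n<1 = empty n<1
  greedy (suc m) n n<F with n ℕₚ.<? F (suc m)
  ... | yes n<F′ = weaken (greedy m n n<F′)
  ... | no  n≮F′ = subst (Below (suc m)) (ℕₚ.m∸n+n≡m F≤n) (add m (top m _ r<F))
    where
    F≤n = ℕₚ.≮⇒≥ n≮F′
    r<F : n ℕ.∸ F (suc m) ℕ.< F m
    r<F = ℕₚ.+-cancelʳ-< (F (suc m)) _ _
      (subst₂ ℕ._<_ (sym (ℕₚ.m∸n+n≡m F≤n)) (ℕₚ.+-comm (F (suc m)) (F m)) n<F)

  top zero    r r<1 = empty r<1
  top (suc m) r r<F = greedy m r r<F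

  n<F[1+n] : ∀ n → n ℕ.< F (suc n)
  1≤F : ∀ n → 1 ℕ.≤ F n
  1≤F zero    = s≤s z≤n
  1≤F (suc n) = ℕₚ.≤-trans (s≤s z≤n) (n<F[1+n] n)
  n<F[1+n] zero    = s≤s z≤n
  n<F[1+n] (suc n) =
    subst (ℕ._≤ F (suc (suc n))) (ℕₚ.+-comm (suc n) 1) (ℕₚ.+-mono-≤ (n<F[1+n] n) (1≤F n))

  trim : ∀ m {n} → 1 ℕ.≤ n → Below m n → Zeckendorf n
  trim zero    1≤n b = ⊥-elim (ℕₚ.<⇒≢ 1≤n (sym (Below.sums b)))
  trim (suc m) 1≤n b with Below.binary b (suc m)
  ... | inj₂ occurs = record
    { iₘₐₓ = suc m ; δ = δ ; δ-binary = binary ; iₘₐₓ-positive = s≤s z≤n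
    ; iₘₐₓ-occurs = occurs ; iₘₐₓ-largest = above ; nonconsecutive = noncon
    ; represents = sums }
    where open Below b
  ... | inj₁ absent = trim m 1≤n (record
    { δ = δ ; binary = binary ; above = ab ; noncon = noncon
    ; sums = trans sums (∑₁-extend m (suc m) (ℕ.≤′-step ℕ.≤′-refl)
                          (λ i lt → cong (ℕ._* F i) (ab i lt))) })
    where
    open Below b
    ab : ∀ i → m ℕ.< i → δ i ≡ 0
    ab i m<i with ℕₚ.m≤n⇒m<n∨m≡n m<i
    ... | inj₁ lt   = above i lt
    ... | inj₂ refl = absent

-- Hence quantifying over the decompositions of n is never vacuous.
zeckendorf : ∀ n → 1 ℕ.≤ n → Zeckendorf n
zeckendorf n 1≤n = trim n 1≤n (greedy n n (n<F[1+n] n))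

{-# OPTIONS --safe #-}
-- The function a extends to states additively.  Its value on a state goes up
-- by i under C_i and by exactly 1 under every S_i, and it vanishes on {F_1^n},
-- so a path has at most as many moves as its value on the final state.  That
-- state is the Zeckendorf decomposition, because moves preserve the total, a
-- terminal state has no repeated or consecutive indices, and such a
-- representation is unique.
--
-- Twice the difference of the two sides of the second inequality is V√5 - U
-- with U = ∑ (F_i + 2 F_{i-1} - 3) δ_i and V = ∑ (F_i - 1) δ_i.  The cone
-- U² ≤ 5V² is closed under addition, so it suffices to treat each summand.
module Submission where

open import Defs
open import Data.Nat.Base using (ℕ; _≤_; zero; suc; _+_; _*_; _<_; _≤′_; ≤′-refl; ≤′-step; z≤n; s≤s; s≤s⁻¹)
open import Data.Nat.Properties as ℕₚ using (_≟_)
open import Data.Nat.ListAction using (sum)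
open import Data.Nat.ListAction.Properties using (sum-++; sum-↭)
open import Data.Nat.Tactic.RingSolver using (solve-∀)
open import Data.Integer.Base as ℤ using (+_)
import Data.Integer.Properties as ℤₚ
import Data.Integer.Tactic.RingSolver as ℤ-Solver
open import Data.Rational.Base as ℚ using (ℚ; 0ℚ; ½)
import Data.Rational.Properties as ℚₚ
import Data.Rational.Unnormalised.Base as ℚᵘ
import Data.Rational.Unnormalised.Properties as ℚᵘₚ
open import Data.Rational.Solver using (module +-*-Solver)
open import Data.List.Base using ([]; _∷_; _++_; map)
open import Data.List.Extrema.Nat using (max; ⊥≤max; xs≤max)
open import Data.List.Properties using (map-++)
open import Data.List.Relation.Binary.Permutation.Propositional using (_↭_; ↭-refl; ↭-sym; ↭-trans; prep; swap)
open import Data.List.Relation.Binary.Permutation.Propositional.Properties using (map⁺; All-resp-↭)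
open import Data.List.Relation.Unary.All using (All; []; _∷_)
open import Data.List.Relation.Unary.All.Properties using (++⁺; ++⁻ʳ; replicate⁺)
open import Data.Product.Base using (_×_; _,_; ∃; ∃₂)
open import Data.Sum.Base using (_⊎_; inj₁; inj₂)
open import Function.Base using (_∘_)
open import Relation.Nullary using (¬_; yes; no; contradiction)
open import Relation.Binary.Construct.Closure.ReflexiveTransitive using (Star; ε; _◅_)
open import Relation.Binary.PropositionalEquality

-- Finite sums

∑₁-cong : ∀ m {f g : ℕ → ℕ} → (∀ i → f i ≡ g i) → ∑₁ m f ≡ ∑₁ m g
∑₁-cong zero    e = refl
∑₁-cong (suc m) e = cong₂ _+_ (∑₁-cong m e) (e (suc m))

∑₁-zero : ∀ m {f : ℕ → ℕ} → (∀ i → i ≤ m → f i ≡ 0) → ∑₁ m f ≡ 0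
∑₁-zero zero    e = refl
∑₁-zero (suc m) e =
  cong₂ _+_ (∑₁-zero m (λ i i≤m → e i (ℕₚ.m≤n⇒m≤1+n i≤m))) (e (suc m) ℕₚ.≤-refl)

∑₁-extend : ∀ k m {f : ℕ → ℕ} → k ≤′ m → (∀ i → k < i → f i ≡ 0) → ∑₁ m f ≡ ∑₁ k f
∑₁-extend k .k      ≤′-refl       _ = refl
∑₁-extend k (suc m) (≤′-step k≤m) e =
  trans (cong₂ _+_ (∑₁-extend k m k≤m e) (e (suc m) (s≤s (ℕₚ.≤′⇒≤ k≤m)))) (ℕₚ.+-identityʳ _)

∑₁-distrib-+ : ∀ m (f g : ℕ → ℕ) → ∑₁ m (λ i → f i + g i) ≡ ∑₁ m f + ∑₁ m g
∑₁-distrib-+ zero    f g = refl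
∑₁-distrib-+ (suc m) f g rewrite ∑₁-distrib-+ m f g =
  interchange (∑₁ m f) (∑₁ m g) (f (suc m)) (g (suc m))
  where
  interchange : ∀ p q r s → (p + q) + (r + s) ≡ (p + r) + (q + s)
  interchange = solve-∀

∑₁ℤ-+ : ∀ m {f : ℕ → ℤ.ℤ} {g : ℕ → ℕ} → (∀ i → f i ≡ + g i) → ∑₁ℤ m f ≡ + ∑₁ m g
∑₁ℤ-+ zero    e = refl
∑₁ℤ-+ (suc m) e = cong₂ ℤ._+_ (∑₁ℤ-+ m e) (e (suc m))

-- The weights a_i as natural numbers

-- A recurrence in place of the closed form avoids truncated subtraction, and its last summand is
-- exactly what a move `C` gains.
aₙ : ℕ → ℕ
aₙ 0             = 0
aₙ 1             = 0
aₙ (suc (suc i)) = aₙ (suc i) + aₙ i + suc i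

aₙ-F : ∀ i → aₙ i + (i + 2) ≡ F (2 + i)
aₙ-F 0 = refl
aₙ-F 1 = refl
aₙ-F (suc (suc i)) = begin
  aₙ (suc i) + aₙ i + suc i + (2 + i + 2)            ≡⟨ regroup (aₙ (suc i)) (aₙ i) i ⟩
  (aₙ (suc i) + (suc i + 2)) + (aₙ i + (i + 2))      ≡⟨ cong₂ _+_ (aₙ-F (suc i)) (aₙ-F i) ⟩
  F (4 + i)                                          ∎
  where
  open ≡-Reasoning
  regroup : ∀ p q i → p + q + suc i + (2 + i + 2) ≡ (p + (suc i + 2)) + (q + (i + 2))
  regroup = solve-∀

a≡aₙ : ∀ i → a i ≡ + aₙ i
a≡aₙ i = begin
  + F (i + 2) ℤ.- + i ℤ.- + 2               ≡⟨ cong (λ k → + F k ℤ.- + i ℤ.- + 2) (ℕₚ.+-comm i 2) ⟩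
  + F (2 + i) ℤ.- + i ℤ.- + 2               ≡⟨ cong (λ k → + k ℤ.- + i ℤ.- + 2) (aₙ-F i) ⟨
  + (aₙ i + (i + 2)) ℤ.- + i ℤ.- + 2        ≡⟨ cancel (+ aₙ i) (+ i) ⟩
  + aₙ i                                    ∎
  where
  open ≡-Reasoning
  cancel : ∀ x i → (x ℤ.+ (i ℤ.+ + 2)) ℤ.- i ℤ.- + 2 ≡ x
  cancel = ℤ-Solver.solve-∀

∑aδ≡∑aₙδ : ∀ {n} (z : Zeckendorf n) →
  ∑aδ z ≡ + ∑₁ (Zeckendorf.iₘₐₓ z) (λ i → Zeckendorf.δ z i * aₙ i)
∑aδ≡∑aₙδ z = ∑₁ℤ-+ iₘₐₓ λ i → begin
  a i ℤ.* + δ i        ≡⟨ cong (ℤ._* + δ i) (a≡aₙ i) ⟩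
  + aₙ i ℤ.* + δ i     ≡⟨ ℤₚ.pos-* (aₙ i) (δ i) ⟨
  + (aₙ i * δ i)       ≡⟨ cong +_ (ℕₚ.*-comm (aₙ i) (δ i)) ⟩
  + (δ i * aₙ i)       ∎
  where
  open ≡-Reasoning
  open Zeckendorf z

-- Additive functions of states

total : (ℕ → ℕ) → State → ℕ
total f s = sum (map f s)

total-↭ : ∀ f {s t} → s ↭ t → total f s ≡ total f t
total-↭ f s↭t = sum-↭ (map⁺ f s↭t)

total-++ : ∀ f s t → total f (s ++ t) ≡ total f s + total f t
total-++ f s t = trans (cong sum (map-++ f s t)) (sum-++ (map f s) (map f t))

rule-preserves-F : ∀ {old new} → Rule old new → total F old ≡ total F new
rule-preserves-F C₁    = refl
rule-preserves-F (C k) = eq (F (1 + k)) (F k)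
  where
  eq : ∀ x y → x + ((x + y) + 0) ≡ ((x + y) + x) + 0
  eq = solve-∀
rule-preserves-F S₂    = refl
rule-preserves-F (S k) = eq (F (1 + k)) (F k)
  where
  eq : ∀ x y → ((x + y) + x) + (((x + y) + x) + 0) ≡ x + ((((x + y) + x) + (x + y)) + 0)
  eq = solve-∀

rule-increases-aₙ : ∀ {old new} → Rule old new → total aₙ old < total aₙ new
rule-increases-aₙ C₁    = ℕₚ.≤-refl
-- The gain is `2 + k`; one unit proves the strict inequality and the surplus `suc k` is discarded.
rule-increases-aₙ (C k) = ℕₚ.≤-trans (ℕₚ.m≤m+n _ (suc k)) (ℕₚ.≤-reflexive (eq (aₙ (1 + k)) (aₙ (2 + k)) k))
  where
  eq : ∀ x y k → suc (x + (y + 0)) + suc k ≡ (y + x + suc (suc k)) + 0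
  eq = solve-∀
rule-increases-aₙ S₂    = ℕₚ.≤-refl
rule-increases-aₙ (S k) = ℕₚ.≤-reflexive (eq (aₙ (1 + k)) (aₙ (2 + k)) k)
  where
  -- `w` is `aₙ (3 + k)` unfolded. The last summands `2 + k` and `3 + k` of two successive
  -- recurrences differ by 1, which is the whole gain.
  eq : ∀ x y k → let w = y + x + suc (suc k) in
       suc (w + (w + 0)) ≡ x + ((w + y + suc (suc (suc k))) + 0)
  eq = solve-∀

⟶-preserves-F : ∀ {s t} → s ⟶ t → total F s ≡ total F t
⟶-preserves-F {s} {t} (move {old} {new} rest r s↭ t↭) = begin
  total F s                        ≡⟨ total-↭ F s↭ ⟩
  total F (old ++ rest)            ≡⟨ total-++ F old rest ⟩
  total F old + total F rest       ≡⟨ cong (_+ total F rest) (rule-preserves-F r) ⟩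
  total F new + total F rest       ≡⟨ total-++ F new rest ⟨
  total F (new ++ rest)            ≡⟨ total-↭ F t↭ ⟨
  total F t                        ∎
  where open ≡-Reasoning

⟶-increases-aₙ : ∀ {s t} → s ⟶ t → total aₙ s < total aₙ t
⟶-increases-aₙ {s} {t} (move {old} {new} rest r s↭ t↭) = begin-strict
  total aₙ s                       ≡⟨ total-↭ aₙ s↭ ⟩
  total aₙ (old ++ rest)           ≡⟨ total-++ aₙ old rest ⟩
  total aₙ old + total aₙ rest     <⟨ ℕₚ.+-monoˡ-< (total aₙ rest) (rule-increases-aₙ r) ⟩
  total aₙ new + total aₙ rest     ≡⟨ total-++ aₙ new rest ⟨
  total aₙ (new ++ rest)           ≡⟨ total-↭ aₙ t↭ ⟨
  total aₙ t                       ∎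
  where open ℕₚ.≤-Reasoning

-- A state is a list of arbitrary naturals, and an entry 0 would be invisible to `∑₁`. No move
-- creates one.
Positive : State → Set
Positive = All (1 ≤_)

⟶-preserves-positive : ∀ {s t} → s ⟶ t → Positive s → Positive t
⟶-preserves-positive (move {old} rest r s↭ t↭) s>0 =
  All-resp-↭ (↭-sym t↭) (++⁺ (new>0 r) (++⁻ʳ old (All-resp-↭ s↭ s>0)))
  where
  new>0 : ∀ {old new} → Rule old new → Positive new
  new>0 C₁    = s≤s z≤n ∷ []
  new>0 (C k) = s≤s z≤n ∷ []
  new>0 S₂    = s≤s z≤n ∷ s≤s z≤n ∷ []
  new>0 (S k) = s≤s z≤n ∷ s≤s z≤n ∷ []

⟶*-preserves-F : ∀ {s t} → Star _⟶_ s t → total F s ≡ total F t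
⟶*-preserves-F ε        = refl
⟶*-preserves-F (m ◅ ms) = trans (⟶-preserves-F m) (⟶*-preserves-F ms)

⟶*-preserves-positive : ∀ {s t} → Star _⟶_ s t → Positive s → Positive t
⟶*-preserves-positive ε        s>0 = s>0
⟶*-preserves-positive (m ◅ ms) s>0 = ⟶*-preserves-positive ms (⟶-preserves-positive m s>0)

-- The value at `s` stays on the left so that the induction can run through every intermediate
-- state.
#moves+aₙ≤aₙ : ∀ {s t} (ms : Star _⟶_ s t) → #moves ms + total aₙ s ≤ total aₙ t
#moves+aₙ≤aₙ ε                = ℕₚ.≤-refl
#moves+aₙ≤aₙ {s} {t} (_◅_ {j = u} m ms) = begin
  suc (#moves ms + total aₙ s)     ≡⟨ ℕₚ.+-suc (#moves ms) (total aₙ s) ⟨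
  #moves ms + suc (total aₙ s)     ≤⟨ ℕₚ.+-monoʳ-≤ (#moves ms) (⟶-increases-aₙ m) ⟩
  #moves ms + total aₙ u           ≤⟨ #moves+aₙ≤aₙ ms ⟩
  total aₙ t                       ∎
  where open ℕₚ.≤-Reasoning

total-F-start : ∀ n → total F (start n) ≡ n
total-F-start zero    = refl
total-F-start (suc n) = cong suc (total-F-start n)

-- Multiplicities

indicator : ℕ → ℕ → ℕ
indicator i j with i ≟ j
... | yes _ = 1
... | no  _ = 0

indicator-≡ : ∀ i → indicator i i ≡ 1
indicator-≡ i with i ≟ i
... | yes _  = refl
... | no i≢i = contradiction refl i≢i

indicator-≢ : ∀ {i j} → i ≢ j → indicator i j ≡ 0
indicator-≢ {i} {j} i≢j with i ≟ j
... | yes i≡j = contradiction i≡j i≢j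
... | no _    = refl

count : ℕ → State → ℕ
count i = total (indicator i)

-- Brings an occurring index to the head of the list, the form in which a move can be applied.
count>0⇒↭ : ∀ i s → 1 ≤ count i s → ∃ λ r → s ↭ i ∷ r
count>0⇒↭ i (j ∷ s) p with i ≟ j
... | yes refl = s , ↭-refl
... | no  _    with count>0⇒↭ i s p
...   | r , s↭ = j ∷ r , ↭-trans (prep j s↭) (swap j i ↭-refl)

count-0 : ∀ {s} → Positive s → count 0 s ≡ 0
count-0 []              = refl
count-0 (s≤s _ ∷ s>0)   = count-0 s>0

∑₁-indicator : ∀ m (f : ℕ → ℕ) {j} → 1 ≤ j → j ≤ m → ∑₁ m (λ i → indicator i j * f i) ≡ f j
∑₁-indicator zero    f 1≤j j≤0 = contradiction (ℕₚ.≤-trans 1≤j j≤0) λ ()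
∑₁-indicator (suc m) f {j} 1≤j j≤1+m with suc m ≟ j
... | yes refl = cong₂ _+_
      (∑₁-zero m λ i i≤m → cong (_* f i) (indicator-≢ (ℕₚ.<⇒≢ (s≤s i≤m))))
      (ℕₚ.*-identityˡ (f (suc m)))
... | no 1+m≢j = trans (ℕₚ.+-identityʳ _)
      (∑₁-indicator m f 1≤j (s≤s⁻¹ (ℕₚ.≤∧≢⇒< j≤1+m (1+m≢j ∘ sym))))

-- Passes from a list to its coefficient sequence, which can be compared with `δ`. The bound `m` is
-- left free so that both can be summed over a common range.
total≡∑₁-count : ∀ m f {s} → Positive s → All (_≤ m) s → total f s ≡ ∑₁ m (λ i → count i s * f i)
total≡∑₁-count m f []           []          = sym (∑₁-zero m λ _ _ → refl)
total≡∑₁-count m f {j ∷ s} (1≤j ∷ s>0) (j≤m ∷ s≤m) = sym (begin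
  ∑₁ m (λ i → (indicator i j + count i s) * f i)
    ≡⟨ ∑₁-cong m (λ i → ℕₚ.*-distribʳ-+ (f i) (indicator i j) (count i s)) ⟩
  ∑₁ m (λ i → indicator i j * f i + count i s * f i)
    ≡⟨ ∑₁-distrib-+ m _ _ ⟩
  ∑₁ m (λ i → indicator i j * f i) + ∑₁ m (λ i → count i s * f i)
    ≡⟨ cong₂ _+_ (∑₁-indicator m f 1≤j j≤m) (sym (total≡∑₁-count m f s>0 s≤m)) ⟩
  f j + total f s ∎)
  where open ≡-Reasoning

-- Uniqueness of Zeckendorf decompositions

-- The digit conditions of `Zeckendorf`, isolated so that they also apply to the multiplicities in a
-- terminal state.
record Sparse (δ : ℕ → ℕ) : Set where
  field
    binary         : ∀ i → δ i ≡ 0 ⊎ δ i ≡ 1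
    nonconsecutive : ∀ i → 1 ≤ i → ¬ (δ i ≡ 1 × δ (suc i) ≡ 1)

-- Any violation would permit a move: a repeated index allows `C₁`, `S₂` or `S k` according to its
-- size, and two neighbouring indices allow `C k`.
terminal⇒sparse : ∀ {s} → Positive s → Terminal s → Sparse (λ i → count i s)
terminal⇒sparse {s} s>0 end = record { binary = binary ; nonconsecutive = nonconsecutive }
  where
  no-repeats : ∀ i r → 1 ≤ i → ¬ (s ↭ i ∷ i ∷ r)
  no-repeats (suc zero)          r _ s↭ = end _ (move r C₁ s↭ ↭-refl)
  no-repeats (suc (suc zero))    r _ s↭ = end _ (move r S₂ s↭ ↭-refl)
  no-repeats (suc (suc (suc k))) r _ s↭ = end _ (move r (S k) s↭ ↭-refl)

  binary : ∀ i → count i s ≡ 0 ⊎ count i s ≡ 1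
  binary zero = inj₁ (count-0 s>0)
  binary i@(suc _) with count i s in eq
  ... | zero        = inj₁ refl
  ... | suc zero    = inj₂ refl
  -- Taking out one copy of `i` leaves `suc c` copies, so a second one can be taken out.
  ... | suc (suc c) with count>0⇒↭ i s (subst (1 ≤_) (sym eq) (s≤s z≤n))
  ...   | r , s↭ with count>0⇒↭ i r (subst (1 ≤_) (sym count-r) (s≤s z≤n))
    where
    count-r : count i r ≡ suc c
    count-r = ℕₚ.suc-injective (begin
      1 + count i r                ≡⟨ cong (_+ count i r) (indicator-≡ i) ⟨
      indicator i i + count i r    ≡⟨ total-↭ (indicator i) s↭ ⟨
      count i s                    ≡⟨ eq ⟩
      suc (suc c)                  ∎)
      where open ≡-Reasoning
  ...     | r′ , r↭ = contradiction (↭-trans s↭ (prep i r↭)) (no-repeats i r′ (s≤s z≤n))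

  nonconsecutive : ∀ i → 1 ≤ i → ¬ (count i s ≡ 1 × count (suc i) s ≡ 1)
  nonconsecutive i@(suc k) _ (p , q) with count>0⇒↭ i s (ℕₚ.≤-reflexive (sym p))
  ... | r , s↭ with count>0⇒↭ (suc i) r (ℕₚ.≤-reflexive (sym count-r))
    where
    count-r : count (suc i) r ≡ 1
    count-r = begin
      count (suc i) r                          ≡⟨ cong (_+ count (suc i) r) (indicator-≢ (ℕₚ.1+n≢n {i})) ⟨
      indicator (suc i) i + count (suc i) r    ≡⟨ total-↭ (indicator (suc i)) s↭ ⟨
      count (suc i) s                          ≡⟨ q ⟩
      1                                        ∎
      where open ≡-Reasoning
  ...   | r′ , r↭ = end _ (move r′ (C k) (↭-trans s↭ (prep i r↭)) ↭-refl)

module _ {δ} (δ-sparse : Sparse δ) where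
  open Sparse δ-sparse

  -- If the top digit is 1, the digit below it is 0, so the rest is less than `F (suc m)` and the
  -- recurrence for `F` closes the step. This is why the induction goes back two indices.
  sparse-bound : ∀ m → ∑₁ m (λ i → δ i * F i) < F (suc m)
  sparse-bound 0 = s≤s z≤n
  sparse-bound 1 with binary 1
  ... | inj₁ e rewrite e = s≤s z≤n
  ... | inj₂ e rewrite e = s≤s (s≤s z≤n)
  sparse-bound (suc (suc m)) = step (sparse-bound m) (sparse-bound (suc m))
    where
    step : ∑₁ m (λ i → δ i * F i) < F (suc m) → ∑₁ (suc m) (λ i → δ i * F i) < F (2 + m) →
      ∑₁ (2 + m) (λ i → δ i * F i) < F (3 + m)
    step p p′ with binary (2 + m) | binary (suc m)
    ... | inj₁ e | _ rewrite e | ℕₚ.+-identityʳ (∑₁ (suc m) (λ i → δ i * F i)) =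
      ℕₚ.<-≤-trans p′ (ℕₚ.m≤m+n _ _)
    ... | inj₂ e | inj₂ e′ = contradiction (e′ , e) (nonconsecutive (suc m) (s≤s z≤n))
    ... | inj₂ e | inj₁ e′ rewrite e | e′ | ℕₚ.+-identityʳ (∑₁ m (λ i → δ i * F i))
                                 | ℕₚ.+-identityʳ (F (2 + m)) =
      ℕₚ.<-≤-trans (ℕₚ.+-monoˡ-< (F (2 + m)) p) (ℕₚ.≤-reflexive (ℕₚ.+-comm (F (suc m)) (F (2 + m))))

-- Induction from the top: equal sums force equal top digits, whose terms then cancel. The
-- conclusion allows every weight `f` because the equality is to be carried over from `F` to `aₙ`.
sparse-unique : ∀ {δ γ : ℕ → ℕ} → Sparse δ → Sparse γ → ∀ m →
  ∑₁ m (λ i → δ i * F i) ≡ ∑₁ m (λ i → γ i * F i) →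
  ∀ (f : ℕ → ℕ) → ∑₁ m (λ i → δ i * f i) ≡ ∑₁ m (λ i → γ i * f i)
sparse-unique δ-sparse γ-sparse zero    _  f = refl
sparse-unique {δ} {γ} δ-sparse γ-sparse (suc m) eq f = cong₂ _+_
  (sparse-unique δ-sparse γ-sparse m
    (ℕₚ.+-cancelʳ-≡ (δ (suc m) * F (suc m)) _ _
      (trans eq (cong (λ d → ∑₁ m (λ i → γ i * F i) + d * F (suc m)) (sym top)))) f)
  (cong (_* f (suc m)) top)
  where
  -- With top digit 0 the sum stays below `F (suc m)` by `sparse-bound`; with top digit 1 it is at
  -- least that.
  clash : ∀ {δ γ : ℕ → ℕ} → Sparse γ → δ (suc m) ≡ 1 → γ (suc m) ≡ 0 →
    ¬ (∑₁ (suc m) (λ i → δ i * F i) ≡ ∑₁ (suc m) (λ i → γ i * F i))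
  clash {δ} {γ} γ-sparse d e eq rewrite d | e = ℕₚ.<⇒≢
    (ℕₚ.<-≤-trans (sparse-bound γ-sparse m) (ℕₚ.≤-trans (ℕₚ.m≤m+n _ 0) (ℕₚ.m≤n+m _ (∑₁ m (λ i → δ i * F i)))))
    (trans (sym (ℕₚ.+-identityʳ _)) (sym eq))
  top : δ (suc m) ≡ γ (suc m)
  top with Sparse.binary δ-sparse (suc m) | Sparse.binary γ-sparse (suc m)
  ... | inj₁ d | inj₁ e = trans d (sym e)
  ... | inj₂ d | inj₂ e = trans d (sym e)
  ... | inj₂ d | inj₁ e = contradiction eq (clash {δ} γ-sparse d e)
  ... | inj₁ d | inj₂ e = contradiction (sym eq) (clash {γ} δ-sparse e d)

-- The multiplicities in `s` and the digits `δ` are sparse representations of the same number, so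
-- uniqueness evaluates every additive function at `s`.
terminal-total : ∀ {n} (z : Zeckendorf n) {s} → Positive s → Terminal s →
  total F s ≡ n → ∀ f → total f s ≡ ∑₁ (Zeckendorf.iₘₐₓ z) (λ i → Zeckendorf.δ z i * f i)
terminal-total {n} z {s} s>0 end value f = begin
  total f s                        ≡⟨ total≡∑₁-count m f s>0 s≤m ⟩
  ∑₁ m (λ i → count i s * f i)     ≡⟨ sparse-unique (terminal⇒sparse s>0 end) δ-sparse m same-value f ⟩
  ∑₁ m (λ i → δ i * f i)           ≡⟨ truncate f ⟩
  ∑₁ iₘₐₓ (λ i → δ i * f i)        ∎
  where
  open ≡-Reasoning
  open Zeckendorf z
  m : ℕ
  -- A common range for both sequences; beyond `iₘₐₓ` the digits `δ` are padded by zeros.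
  m = max iₘₐₓ s
  s≤m : All (_≤ m) s
  s≤m = xs≤max iₘₐₓ s
  δ-sparse : Sparse δ
  δ-sparse = record { binary = δ-binary ; nonconsecutive = nonconsecutive }
  truncate : ∀ f → ∑₁ m (λ i → δ i * f i) ≡ ∑₁ iₘₐₓ (λ i → δ i * f i)
  truncate f = ∑₁-extend iₘₐₓ m (ℕₚ.≤⇒≤′ (⊥≤max iₘₐₓ s)) λ i lt → cong (_* f i) (iₘₐₓ-largest i lt)
  same-value : ∑₁ m (λ i → count i s * F i) ≡ ∑₁ m (λ i → δ i * F i)
  same-value = begin
    ∑₁ m (λ i → count i s * F i)   ≡⟨ total≡∑₁-count m F s>0 s≤m ⟨
    total F s                      ≡⟨ value ⟩
    n                              ≡⟨ represents ⟩
    ∑₁ iₘₐₓ (λ i → δ i * F i)      ≡⟨ truncate F ⟨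
    ∑₁ m (λ i → δ i * F i)         ∎

-- The bound on the length of a path

pathLength≤∑aδ : ∀ {n} (z : Zeckendorf n) (p : GamePath n) → + pathLength p ℤ.≤ ∑aδ z
pathLength≤∑aδ {n} z p = subst (+ pathLength p ℤ.≤_) (sym (∑aδ≡∑aₙδ z)) (ℤ.+≤+ (begin
  #moves moves                             ≤⟨ ℕₚ.m≤m+n _ _ ⟩
  #moves moves + total aₙ (start n)        ≤⟨ #moves+aₙ≤aₙ moves ⟩
  total aₙ end                             ≡⟨ terminal-total z end>0 terminal end-value aₙ ⟩
  ∑₁ iₘₐₓ (λ i → δ i * aₙ i)               ∎))
  where
  open ℕₚ.≤-Reasoning hiding (start)
  open GamePath p
  open Zeckendorf z
  end>0 : Positive end
  end>0 = ⟶*-preserves-positive moves (replicate⁺ n (s≤s z≤n))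
  end-value : total F end ≡ n
  end-value = trans (sym (⟶*-preserves-F moves)) (total-F-start n)

-- The cone u ≤ √5 v

_≤√5·_ : ℕ → ℕ → Set
u ≤√5· v = u * u ≤ 5 * (v * v)

m²≤n²⇒m≤n : ∀ {m n} → m * m ≤ n * n → m ≤ n
m²≤n²⇒m≤n m²≤n² = ℕₚ.≮⇒≥ λ n<m → ℕₚ.<⇒≱ (ℕₚ.*-mono-< n<m n<m) m²≤n²

-- The squares are bounded by the hypotheses. The cross term needs `u * u′ ≤ 5 * (v * v′)`, which is
-- the product of the hypotheses after taking square roots.
≤√5·-+ : ∀ {u v u′ v′} → u ≤√5· v → u′ ≤√5· v′ → (u + u′) ≤√5· (v + v′)
≤√5·-+ {u} {v} {u′} {v′} p p′ = begin
  (u + u′) * (u + u′)                                    ≡⟨ square u u′ ⟩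
  u * u + u′ * u′ + 2 * (u * u′)                         ≤⟨ ℕₚ.+-mono-≤ (ℕₚ.+-mono-≤ p p′) (ℕₚ.*-monoʳ-≤ 2 cross) ⟩
  5 * (v * v) + 5 * (v′ * v′) + 2 * (5 * (v * v′))       ≡⟨ square₅ v v′ ⟨
  5 * ((v + v′) * (v + v′))                              ∎
  where
  open ℕₚ.≤-Reasoning
  square : ∀ x y → (x + y) * (x + y) ≡ x * x + y * y + 2 * (x * y)
  square = solve-∀
  square₅ : ∀ x y → 5 * ((x + y) * (x + y)) ≡ 5 * (x * x) + 5 * (y * y) + 2 * (5 * (x * y))
  square₅ = solve-∀
  product² : ∀ x y → (x * y) * (x * y) ≡ (x * x) * (y * y)
  product² = solve-∀
  product₅ : ∀ x y → (5 * (x * x)) * (5 * (y * y)) ≡ (5 * (x * y)) * (5 * (x * y))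
  product₅ = solve-∀
  cross : u * u′ ≤ 5 * (v * v′)
  cross = m²≤n²⇒m≤n (begin
    (u * u′) * (u * u′)                      ≡⟨ product² u u′ ⟩
    (u * u) * (u′ * u′)                      ≤⟨ ℕₚ.*-mono-≤ p p′ ⟩
    (5 * (v * v)) * (5 * (v′ * v′))          ≡⟨ product₅ v v′ ⟩
    (5 * (v * v′)) * (5 * (v * v′))          ∎)

-- This is `F i` minus 1, by a recurrence free of subtraction. The summands of V and U at index
-- `suc i` become `F⁻ (suc i)` and `F⁻ (suc i) + 2 * F⁻ i`.
F⁻ : ℕ → ℕ
F⁻ 0             = 0
F⁻ 1             = 0
F⁻ (suc (suc i)) = suc (F⁻ (suc i) + F⁻ i)

F≡1+F⁻ : ∀ i → F i ≡ suc (F⁻ i)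
F≡1+F⁻ 0 = refl
F≡1+F⁻ 1 = refl
F≡1+F⁻ (suc (suc i)) rewrite F≡1+F⁻ (suc i) | F≡1+F⁻ i = cong suc (ℕₚ.+-suc _ _)

-- lower and upper turn into each other when (x , y) = (F i - 1 , F (i + 1) - 1)
-- is replaced by (y , 1 + (y + x)); they stand in for Cassini's identity.
record Cassini (x y : ℕ) : Set where
  field
    x≤y   : x ≤ y
    lower : x * x + y * x ≤ y * y
    upper : y * y ≤ x * x + y * x + y + 2 * x + 1

cassini : ∀ i → Cassini (F⁻ i) (F⁻ (suc i))
cassini zero    = record { x≤y = z≤n ; lower = z≤n ; upper = z≤n }
cassini (suc i) = step (F⁻ i) (F⁻ (suc i)) (cassini i)
  where
  open ℕₚ.≤-Reasoning
  eq₁ : ∀ x y → y * y + suc (y + x) * y ≡ y * y + (y * y + y * x + y)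
  eq₁ = solve-∀
  eq₂ : ∀ x y → (x * x + y * x + y + 2 * x + 1) + (y * y + y * x + y) ≡ suc (y + x) * suc (y + x)
  eq₂ = solve-∀
  eq₃ : ∀ x y → suc (y + x) * suc (y + x) ≡ (x * x + y * x) + ((y * y + y * x + 2 * y + x + 1) + x)
  eq₃ = solve-∀
  eq₄ : ∀ x y → (y * y + ((y * y + y * x + 2 * y + x + 1) + y)) + (y + 1)
              ≡ y * y + suc (y + x) * y + suc (y + x) + 2 * y + 1
  eq₄ = solve-∀
  step : ∀ x y → Cassini x y → Cassini y (suc (y + x))
  step x y c = record
    { x≤y   = ℕₚ.m≤n⇒m≤1+n (ℕₚ.m≤m+n y x)
    ; lower = begin
        y * y + suc (y + x) * y                                            ≡⟨ eq₁ x y ⟩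
        y * y + (y * y + y * x + y)                                        ≤⟨ ℕₚ.+-monoˡ-≤ _ upper ⟩
        (x * x + y * x + y + 2 * x + 1) + (y * y + y * x + y)              ≡⟨ eq₂ x y ⟩
        suc (y + x) * suc (y + x)                                          ∎
    ; upper = begin
        suc (y + x) * suc (y + x)                                          ≡⟨ eq₃ x y ⟩
        -- `lower` bounds the first group, and the isolated last `x` is raised to `y`; the target
        -- still exceeds the result by `y + 1`.
        (x * x + y * x) + ((y * y + y * x + 2 * y + x + 1) + x)            ≤⟨ ℕₚ.+-mono-≤ lower (ℕₚ.+-monoʳ-≤ _ x≤y) ⟩
        y * y + ((y * y + y * x + 2 * y + x + 1) + y)                      ≤⟨ ℕₚ.m≤m+n _ (y + 1) ⟩
        (y * y + ((y * y + y * x + 2 * y + x + 1) + y)) + (y + 1)          ≡⟨ eq₄ x y ⟩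
        y * y + suc (y + x) * y + suc (y + x) + 2 * y + 1                  ∎
    }
    where open Cassini c

-- The difference of the two sides is 4 times `y * y - y * x - x * x`, so the claim amounts to
-- `lower`.
F⁻-≤√5· : ∀ i → (F⁻ (suc i) + 2 * F⁻ i) ≤√5· F⁻ (suc i)
F⁻-≤√5· i = begin
  (y + 2 * x) * (y + 2 * x)          ≡⟨ expand x y ⟩
  y * y + 4 * (x * x + y * x)        ≤⟨ ℕₚ.+-monoʳ-≤ (y * y) (ℕₚ.*-monoʳ-≤ 4 (Cassini.lower (cassini i))) ⟩
  5 * (y * y)                        ∎
  where
  open ℕₚ.≤-Reasoning
  x = F⁻ i
  y = F⁻ (suc i)
  expand : ∀ x y → (y + 2 * x) * (y + 2 * x) ≡ y * y + 4 * (x * x + y * x)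
  expand = solve-∀

-- The two sides of the second inequality, summand by summand

aₙ-F⁻ : ∀ i → 2 * aₙ (suc i) + 2 * suc i + 1 ≡ 3 * F (suc i) + (F⁻ (suc i) + 2 * F⁻ i)
-- Adding 3 completes the left side to twice the left side of `aₙ-F (suc i)`.
aₙ-F⁻ i = ℕₚ.+-cancelʳ-≡ 3 _ _ (begin
  2 * aₙ (suc i) + 2 * suc i + 1 + 3                         ≡⟨ regroup (aₙ (suc i)) i ⟩
  2 * (aₙ (suc i) + (suc i + 2))                             ≡⟨ cong (2 *_) (aₙ-F (suc i)) ⟩
  2 * (F (suc i) + F i + F (suc i))                          ≡⟨ cong₂ (λ p q → 2 * (p + q + p)) (F≡1+F⁻ (suc i)) (F≡1+F⁻ i) ⟩
  2 * (suc y + suc x + suc y)                                ≡⟨ expand x y ⟩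
  3 * suc y + (y + 2 * x) + 3                                ≡⟨ cong (λ p → 3 * p + (y + 2 * x) + 3) (F≡1+F⁻ (suc i)) ⟨
  3 * F (suc i) + (y + 2 * x) + 3                            ∎)
  where
  open ≡-Reasoning
  x = F⁻ i
  y = F⁻ (suc i)
  regroup : ∀ p i → 2 * p + 2 * suc i + 1 + 3 ≡ 2 * (p + (suc i + 2))
  regroup = solve-∀
  expand : ∀ x y → 2 * (suc y + suc x + suc y) ≡ 3 * suc y + (y + 2 * x) + 3
  expand = solve-∀

module _ {δ : ℕ → ℕ} (binary : ∀ i → δ i ≡ 0 ⊎ δ i ≡ 1) where

  -- With A and I the sums of `aₙ` and of the indices, the two equations say that √5 (N - Z) + 3N -
  -- 2A - 2I - Z, the doubled difference of the two sides, equals √5 V - U. Stating them additively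
  -- keeps everything in ℕ.
  ∑-≤√5· : ∀ m → let N = ∑₁ m (λ i → δ i * F i) ; Z = ∑₁ m δ in
    ∃₂ λ U V → U ≤√5· V × V + Z ≡ N
      × 2 * ∑₁ m (λ i → δ i * aₙ i) + 2 * ∑₁ m (λ i → i * δ i) + Z ≡ 3 * N + U
  ∑-≤√5· zero = 0 , 0 , z≤n , refl , refl
  ∑-≤√5· (suc m) with ∑-≤√5· m | binary (suc m)
  ... | U , V , U≤V , eq₁ , eq₂ | inj₁ e rewrite e | ℕₚ.*-zeroʳ m =
    U , V , U≤V ,
    trans (cong (λ t → V + t) (ℕₚ.+-identityʳ _)) (trans eq₁ (sym (ℕₚ.+-identityʳ _))) ,
    trans (drop (∑₁ m (λ i → δ i * aₙ i)) (∑₁ m (λ i → i * δ i)) (∑₁ m δ))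
      (trans eq₂ (cong (λ t → 3 * t + U) (sym (ℕₚ.+-identityʳ (∑₁ m (λ i → δ i * F i))))))
    where
    drop : ∀ A I Z → 2 * (A + 0) + 2 * (I + 0) + (Z + 0) ≡ 2 * A + 2 * I + Z
    drop = solve-∀
  ... | U , V , U≤V , eq₁ , eq₂ | inj₂ e rewrite e | ℕₚ.*-identityʳ m
    | ℕₚ.+-identityʳ (F (suc m)) | ℕₚ.+-identityʳ (aₙ (suc m)) =
    U + u , V + v , ≤√5·-+ {U} {V} U≤V (F⁻-≤√5· m) ,
    trans (regroup₁ V v (∑₁ m δ)) (cong₂ _+_ eq₁ (sym (F≡1+F⁻ (suc m)))) ,
    (begin
      2 * (A + aₙ (suc m)) + 2 * (I + suc m) + (∑₁ m δ + 1)
        ≡⟨ regroup₂ A (aₙ (suc m)) I (suc m) (∑₁ m δ) ⟩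
      (2 * A + 2 * I + ∑₁ m δ) + (2 * aₙ (suc m) + 2 * suc m + 1)
        ≡⟨ cong₂ _+_ eq₂ (aₙ-F⁻ m) ⟩
      (3 * N + U) + (3 * F (suc m) + u)
        ≡⟨ regroup₃ N U (F (suc m)) u ⟩
      3 * (N + F (suc m)) + (U + u) ∎)
    where
    open ≡-Reasoning
    v = F⁻ (suc m)
    u = v + 2 * F⁻ m
    A = ∑₁ m (λ i → δ i * aₙ i)
    I = ∑₁ m (λ i → i * δ i)
    N = ∑₁ m (λ i → δ i * F i)
    regroup₁ : ∀ V v Z → V + v + (Z + 1) ≡ V + Z + suc v
    regroup₁ = solve-∀
    regroup₂ : ∀ A p I q Z → 2 * (A + p) + 2 * (I + q) + (Z + 1) ≡ (2 * A + 2 * I + Z) + (2 * p + 2 * q + 1)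
    regroup₂ = solve-∀
    regroup₃ : ∀ N U f u → (3 * N + U) + (3 * f + u) ≡ 3 * (N + f) + (U + u)
    regroup₃ = solve-∀

-- The inequality in ℚ(√5)

ι : ℕ → ℚ
ι n = + n ℚ./ 1

-- Arithmetic in ℚ normalises fractions and is stuck on variables, so identities for `ι` are checked
-- on the unnormalised fraction n/1.
toℚᵘ-ι : ∀ n → ℚ.toℚᵘ (ι n) ℚᵘ.≃ ℚᵘ.mkℚᵘ (+ n) 0
toℚᵘ-ι n = ℚₚ.toℚᵘ-fromℚᵘ (ℚᵘ.mkℚᵘ (+ n) 0)

ι-+ : ∀ m n → ι (m + n) ≡ ι m ℚ.+ ι n
ι-+ m n = ℚₚ.toℚᵘ-injective (begin
  ℚ.toℚᵘ (ι (m + n))                               ≈⟨ toℚᵘ-ι (m + n) ⟩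
  ℚᵘ.mkℚᵘ (+ (m + n)) 0                            ≈⟨ ℚᵘ.*≡* (eq (+ m) (+ n)) ⟩
  ℚᵘ.mkℚᵘ (+ m) 0 ℚᵘ.+ ℚᵘ.mkℚᵘ (+ n) 0             ≈⟨ ℚᵘₚ.+-cong (toℚᵘ-ι m) (toℚᵘ-ι n) ⟨
  ℚ.toℚᵘ (ι m) ℚᵘ.+ ℚ.toℚᵘ (ι n)                   ≈⟨ ℚₚ.toℚᵘ-homo-+ (ι m) (ι n) ⟨
  ℚ.toℚᵘ (ι m ℚ.+ ι n)                             ∎)
  where
  open import Relation.Binary.Reasoning.Setoid ℚᵘₚ.≃-setoid
  eq : ∀ x y → (x ℤ.+ y) ℤ.* + 1 ≡ (x ℤ.* + 1 ℤ.+ y ℤ.* + 1) ℤ.* + 1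
  eq = ℤ-Solver.solve-∀

ι-* : ∀ m n → ι (m * n) ≡ ι m ℚ.* ι n
ι-* m n = ℚₚ.toℚᵘ-injective (begin
  ℚ.toℚᵘ (ι (m * n))                               ≈⟨ toℚᵘ-ι (m * n) ⟩
  ℚᵘ.mkℚᵘ (+ (m * n)) 0                            ≈⟨ ℚᵘ.*≡* (cong (ℤ._* + 1) (ℤₚ.pos-* m n)) ⟩
  ℚᵘ.mkℚᵘ (+ m) 0 ℚᵘ.* ℚᵘ.mkℚᵘ (+ n) 0             ≈⟨ ℚᵘₚ.*-cong (toℚᵘ-ι m) (toℚᵘ-ι n) ⟨
  ℚ.toℚᵘ (ι m) ℚᵘ.* ℚ.toℚᵘ (ι n)                   ≈⟨ ℚₚ.toℚᵘ-homo-* (ι m) (ι n) ⟨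
  ℚ.toℚᵘ (ι m ℚ.* ι n)                             ∎)
  where open import Relation.Binary.Reasoning.Setoid ℚᵘₚ.≃-setoid

ι-mono-≤ : ∀ {m n} → m ≤ n → ι m ℚ.≤ ι n
ι-mono-≤ {m} {n} m≤n = ℚₚ.toℚᵘ-cancel-≤ (begin
  ℚ.toℚᵘ (ι m)        ≃⟨ toℚᵘ-ι m ⟩
  ℚᵘ.mkℚᵘ (+ m) 0     ≤⟨ ℚᵘ.*≤* (ℤₚ.*-monoʳ-≤-nonNeg (+ 1) (ℤ.+≤+ m≤n)) ⟩
  ℚᵘ.mkℚᵘ (+ n) 0     ≃⟨ toℚᵘ-ι n ⟨
  ℚ.toℚᵘ (ι n)        ∎)
  where open ℚᵘₚ.≤-Reasoning

-- The number is (√5 v - u)/2, whose parts have the signs required by `p≤0,q≥0`; the remaining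
-- condition is the cone inequality scaled by 1/4. Giving `p` and `q` through equations allows the
-- unsimplified components of a difference.
≤√5·⇒NonNeg : ∀ {u v p q} → u ≤√5· v → p ≡ ℚ.- (½ ℚ.* ι u) → q ≡ ½ ℚ.* ι v → NonNeg (_+_√5 p q)
≤√5·⇒NonNeg {u} {v} u≤v refl refl = p≤0,q≥0
  (ℚₚ.neg-antimono-≤ (½*ι≥0 u)) (½*ι≥0 v)
  (begin
    ℚ.- (½ ℚ.* ι u) ℚ.* ℚ.- (½ ℚ.* ι u)                ≡⟨ square ½ (ι u) ⟩
    (½ ℚ.* ½) ℚ.* (ι u ℚ.* ι u)                        ≡⟨ cong ((½ ℚ.* ½) ℚ.*_) (ι-* u u) ⟨
    (½ ℚ.* ½) ℚ.* ι (u * u)                            ≤⟨ ℚₚ.*-monoˡ-≤-nonNeg (½ ℚ.* ½) (ι-mono-≤ u≤v) ⟩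
    (½ ℚ.* ½) ℚ.* ι (5 * (v * v))                      ≡⟨ cong ((½ ℚ.* ½) ℚ.*_) (trans (ι-* 5 (v * v)) (cong (ι 5 ℚ.*_) (ι-* v v))) ⟩
    (½ ℚ.* ½) ℚ.* (ι 5 ℚ.* (ι v ℚ.* ι v))              ≡⟨ square₅ ½ (ι 5) (ι v) ⟩
    ι 5 ℚ.* ((½ ℚ.* ι v) ℚ.* (½ ℚ.* ι v))              ∎)
  where
  open ℚₚ.≤-Reasoning
  open +-*-Solver
  ½*ι≥0 : ∀ n → 0ℚ ℚ.≤ ½ ℚ.* ι n
  ½*ι≥0 n = ℚₚ.*-monoˡ-≤-nonNeg ½ (ι-mono-≤ {0} {n} z≤n)
  square : ∀ h x → ℚ.- (h ℚ.* x) ℚ.* ℚ.- (h ℚ.* x) ≡ (h ℚ.* h) ℚ.* (x ℚ.* x)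
  square = solve 2 (λ h x → (:- (h :* x)) :* (:- (h :* x)) := (h :* h) :* (x :* x)) refl
  square₅ : ∀ h f x → (h ℚ.* h) ℚ.* (f ℚ.* (x ℚ.* x)) ≡ f ℚ.* ((h ℚ.* x) ℚ.* (h ℚ.* x))
  square₅ = solve 3 (λ h f x → (h :* h) :* (f :* (x :* x)) := f :* ((h :* x) :* (h :* x))) refl

≼-bound : ∀ {A I Z N U V} → U ≤√5· V → V + Z ≡ N → 2 * A + 2 * I + Z ≡ 3 * N + U →
  fromℕ A ≼ ((fromℕ 3 ⊕ √5) /2) ⊗ fromℕ N ⊖ fromℕ I ⊖ ((fromℕ 1 ⊕ √5) /2) ⊗ fromℕ Z
≼-bound {A} {I} {Z} {N} {U} {V} U≤V eq₁ eq₂ = ≤√5·⇒NonNeg {U} {V} U≤V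
  -- The rational part is written as -U/2 plus half of (3N + U) - (2A + 2I + Z), and the latter
  -- vanishes by `eq₂`.
  (trans (rat-eq (ι A) (ι I) (ι Z) (ι N) (ι U))
    (trans (cong (λ t → ℚ.- (½ ℚ.* ι U) ℚ.+ ½ ℚ.* ((ι 3 ℚ.* ι N ℚ.+ ι U) ℚ.- t)) eq₂′)
      (cancel (ℚ.- (½ ℚ.* ι U)) (ι 3 ℚ.* ι N ℚ.+ ι U))))
  -- Replacing N by V + Z through `eq₁` leaves V/2 as the irrational part.
  (trans (cong (λ t → (ι 3 ℚ.* ½ ℚ.* 0ℚ ℚ.+ ½ ℚ.* t ℚ.- 0ℚ ℚ.- (½ ℚ.* 0ℚ ℚ.+ ½ ℚ.* ι Z)) ℚ.- 0ℚ) eq₁′)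
    (irr-eq (ι V) (ι Z)))
  where
  open +-*-Solver
  eq₁′ : ι N ≡ ι V ℚ.+ ι Z
  eq₁′ = trans (cong ι (sym eq₁)) (ι-+ V Z)
  eq₂′ : ι 2 ℚ.* ι A ℚ.+ ι 2 ℚ.* ι I ℚ.+ ι Z ≡ ι 3 ℚ.* ι N ℚ.+ ι U
  eq₂′ = begin
    ι 2 ℚ.* ι A ℚ.+ ι 2 ℚ.* ι I ℚ.+ ι Z        ≡⟨ cong (ℚ._+ ι Z) (cong₂ ℚ._+_ (ι-* 2 A) (ι-* 2 I)) ⟨
    ι (2 * A) ℚ.+ ι (2 * I) ℚ.+ ι Z            ≡⟨ cong (ℚ._+ ι Z) (ι-+ (2 * A) (2 * I)) ⟨
    ι (2 * A + 2 * I) ℚ.+ ι Z                  ≡⟨ ι-+ (2 * A + 2 * I) Z ⟨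
    ι (2 * A + 2 * I + Z)                      ≡⟨ cong ι eq₂ ⟩
    ι (3 * N + U)                              ≡⟨ ι-+ (3 * N) U ⟩
    ι (3 * N) ℚ.+ ι U                          ≡⟨ cong (ℚ._+ ι U) (ι-* 3 N) ⟩
    ι 3 ℚ.* ι N ℚ.+ ι U                        ∎
    where open ≡-Reasoning
  cancel : ∀ x y → x ℚ.+ ½ ℚ.* (y ℚ.- y) ≡ x
  cancel = solve 2 (λ x y → x :+ con ½ :* (y :- y) := x) refl
  -- The left side is the component as `⊗` and `⊖` produce it, including the products with the zero
  -- irrational parts of embedded naturals.
  rat-eq : ∀ A I Z N U →
    ((ι 3 ℚ.* ½ ℚ.* N ℚ.+ ι 5 ℚ.* (½ ℚ.* 0ℚ)) ℚ.- I ℚ.- (½ ℚ.* Z ℚ.+ ι 5 ℚ.* (½ ℚ.* 0ℚ))) ℚ.- A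
    ≡ ℚ.- (½ ℚ.* U) ℚ.+ ½ ℚ.* ((ι 3 ℚ.* N ℚ.+ U) ℚ.- (ι 2 ℚ.* A ℚ.+ ι 2 ℚ.* I ℚ.+ Z))
  rat-eq = solve 5 (λ A I Z N U →
    ((con (ι 3) :* con ½ :* N :+ con (ι 5) :* (con ½ :* con 0ℚ)) :- I
      :- (con ½ :* Z :+ con (ι 5) :* (con ½ :* con 0ℚ))) :- A
    := (:- (con ½ :* U)) :+ con ½ :* ((con (ι 3) :* N :+ U) :- (con (ι 2) :* A :+ con (ι 2) :* I :+ Z))) refl
  irr-eq : ∀ V Z →
    (ι 3 ℚ.* ½ ℚ.* 0ℚ ℚ.+ ½ ℚ.* (V ℚ.+ Z) ℚ.- 0ℚ ℚ.- (½ ℚ.* 0ℚ ℚ.+ ½ ℚ.* Z)) ℚ.- 0ℚ ≡ ½ ℚ.* V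
  irr-eq = solve 2 (λ V Z →
    (con (ι 3) :* con ½ :* con 0ℚ :+ con ½ :* (V :+ Z) :- con 0ℚ :- (con ½ :* con 0ℚ :+ con ½ :* Z)) :- con 0ℚ
    := con ½ :* V) refl

theorem1p2 : (n : ℕ) → 1 ≤ n → (z : Zeckendorf n) →
    ((p : GamePath n) → + pathLength p ℤ.≤ ∑aδ z)
    × (fromℤ (∑aδ z)
    ≼ ((fromℕ 3 ⊕ √5) /2) ⊗ fromℕ n
    ⊖ fromℕ (Zeckendorf.IZ z)
    ⊖ ((fromℕ 1 ⊕ √5) /2) ⊗ fromℕ (Zeckendorf.Z z))
theorem1p2 n _ z with ∑-≤√5· (Zeckendorf.δ-binary z) (Zeckendorf.iₘₐₓ z)
... | U , V , U≤V , eq₁ , eq₂ = pathLength≤∑aδ z , upper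
  where
  open Zeckendorf z
  -- Only the explicit `n` is abstracted: `IZ` and `Z` depend on `z`, whose type mentions `n`, and
  -- must stay fixed when `n` is exchanged for the sum representing it.
  rhs : ℕ → ℚ√5
  rhs k = ((fromℕ 3 ⊕ √5) /2) ⊗ fromℕ k ⊖ fromℕ IZ ⊖ ((fromℕ 1 ⊕ √5) /2) ⊗ fromℕ Z
  upper : fromℤ (∑aδ z) ≼ rhs n
  upper = subst₂ (λ A k → fromℤ A ≼ rhs k) (sym (∑aδ≡∑aₙδ z)) (sym represents)
    (≼-bound {∑₁ iₘₐₓ (λ i → δ i * aₙ i)} {IZ} {U = U} {V} U≤V eq₁ eq₂)
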